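{- Let $(F_n(X,Y))_{n\ge 0}$ be a sequence of nonzero polynomials with non-negative integer coefficients such that $F_n(0,0)=0$ for every $n\ge 0$. Define $(x_n)_{n\ge 0}$ by $x_0=1$, $x_1\in\mathbb{Z}_{>0}$ and $$x_{n+2}x_n=x_{n+1}^2\bigl(F_n(x_n,x_{n+1})+1\bigr)\qquad(n\ge 0).$$ Then $(x_n)$ is a sequence of positive integers such that $x_n\mid x_{n+1}$ and $x_n\mid F_n(x_n,x_{n+1})$ for every $n\ge 0$. Moreover, for any positive integer $h$, the series $S=\sum_{n=0}^{\infty}\frac{h^n}{x_{n+1}}$ has the infinite continued fraction expansion $$S=\cfrac{a_1}{b_1+\cfrac{a_2}{b_2+\cfrac{a_3}{b_3+\cdots}}},$$ where $a_1=1$, $b_1=x_1-h$, and for $k\ge 1$ $$a_{2k}=h,\quad a_{2k+1}=1,\quad b_{2k}=x_{k-1},\quad b_{2k+1}=\frac{\theta^2x_{k-1}-1}{x_{k-1}}=\frac{F_{k-1}(x_{k-1},x_k)}{x_{k-1}}$$ are rational integers.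
   Context: Notation: $\theta^2x_k=\dfrac{x_{k+2}x_k}{x_{k+1}^2}$ for $k\ge 0$. The value of an infinite continued fraction with partial numerators $a_m$ and partial denominators $b_m$ is $\lim_{m\to\infty}P_m/Q_m$, where $P_0=0$, $Q_0=1$, $P_1=a_1$, $Q_1=b_1$, and $P_{k+2}=b_{k+2}P_{k+1}+a_{k+2}P_k$, $Q_{k+2}=b_{k+2}Q_{k+1}+a_{k+2}Q_k$ for $k\ge 0$ (the limit being taken over $m$ large enough that $Q_m\ne 0$). -}

module Defs where

open import Algebra.Bundles.Raw using (RawSemiring)
import Algebra.Definitions.RawSemiring as RawSemiringDefs
open import Data.Integer.Base as ℤ using (ℤ; +_)
open import Data.List.Base using (List; []; _∷_)
open import Data.Nat.Base as ℕ using (ℕ; zero; suc)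
open import Data.Nat.Properties using (m*n≢0)
open import Data.Product using (Σ-syntax; ∃-syntax; _×_)
open import Data.Rational.Base as ℚ using (ℚ; 0ℚ; 1ℚ; _/_; _÷_; ∣_∣)
open import Level using (0ℓ)
open import Relation.Binary.PropositionalEquality using (_≡_)
open import Relation.Nullary.Negation using (¬_)

fromℤ : ℤ → ℚ
fromℤ i = i / 1

fromℕ : ℕ → ℚ
fromℕ n = fromℤ (+ n)

-- A polynomial Σᵢⱼ cᵢⱼ XⁱYʲ over ℕ, as the list over i of the lists over j of
-- the cᵢⱼ.  Trailing zeros are allowed, so distinct lists may represent the
-- same polynomial.
Poly : Set
Poly = List (List ℕ)

nth : ∀ {A : Set} → A → List A → ℕ → A
nth d []       _       = d
nth d (a ∷ as) zero    = a
nth d (a ∷ as) (suc i) = nth d as i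

coeff : Poly → ℕ → ℕ → ℕ
coeff p i j = nth 0 (nth [] p i) j

NonZeroPoly : Poly → Set
NonZeroPoly p = ¬ (∀ i j → coeff p i j ≡ 0)

module Evaluation (R : RawSemiring 0ℓ 0ℓ) where
  open RawSemiring R
  open RawSemiringDefs R using () renaming (_×_ to _·_)

  eval₁ : List ℕ → Carrier → Carrier
  eval₁ []       y = 0#
  eval₁ (c ∷ cs) y = (c · 1#) + y * eval₁ cs y

  eval : Poly → Carrier → Carrier → Carrier
  eval []       x y = 0#
  eval (p ∷ ps) x y = eval₁ p y + x * eval ps x y

open Evaluation ℕ.+-*-rawSemiring public using () renaming (eval to evalℕ)
open Evaluation ℚ.+-*-rawSemiring public using () renaming (eval to evalℚ)

-- Real numbers are represented by Cauchy sequences of rationals.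
record ℝ : Set where
  field
    approx : ℕ → ℚ
    cauchy : ∀ ε → 0ℚ ℚ.< ε →
             ∃[ N ] ∀ m n → N ℕ.≤ m → N ℕ.≤ n →
               ∣ approx m ℚ.- approx n ∣ ℚ.< ε

open ℝ public

-- The strict inequality |q - S| < ε of real numbers: the approximations of the
-- left-hand side eventually stay below ε by a fixed positive margin δ.
∣_-_∣<_ : ℚ → ℝ → ℚ → Set
∣ q - S ∣< ε =
  ∃[ δ ] 0ℚ ℚ.< δ ×
  (∃[ N ] ∀ m → N ℕ.≤ m → ∣ q ℚ.- approx S m ∣ ℚ.+ δ ℚ.≤ ε)

infix 4 _⟶_

_⟶_ : (ℕ → ℚ) → ℝ → Set
u ⟶ S = ∀ ε → 0ℚ ℚ.< ε → ∃[ N ] ∀ n → N ℕ.≤ n → ∣ u n - S ∣< ε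

partialSum : (ℕ → ℚ) → ℕ → ℚ
partialSum u zero    = 0ℚ
partialSum u (suc n) = partialSum u n ℚ.+ u n

HasSum : (ℕ → ℚ) → ℝ → Set
HasSum u S = partialSum u ⟶ S

-- The entries a 0 and b 0 are never used: partial numerators and denominators
-- are indexed from 1.
module Convergents (a b : ℕ → ℚ) where

  P : ℕ → ℚ
  P zero          = 0ℚ
  P (suc zero)    = a 1
  P (suc (suc k)) = b (2 ℕ.+ k) ℚ.* P (suc k) ℚ.+ a (2 ℕ.+ k) ℚ.* P k

  Q : ℕ → ℚ
  Q zero          = 1ℚ
  Q (suc zero)    = b 1
  Q (suc (suc k)) = b (2 ℕ.+ k) ℚ.* Q (suc k) ℚ.+ a (2 ℕ.+ k) ℚ.* Q k

-- Finitely many of the Q m may vanish, so the limit is taken from some M on.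
HasContinuedFraction : ℝ → (a b : ℕ → ℚ) → Set
HasContinuedFraction S a b =
  Σ[ M ∈ ℕ ] Σ[ Q≢0 ∈ (∀ m → ℚ.NonZero (Q (M ℕ.+ m))) ]
    (λ m → _÷_ (P (M ℕ.+ m)) (Q (M ℕ.+ m)) {{Q≢0 m}}) ⟶ S
  where open Convergents a b

θ² : (x : ℕ → ℕ) → (∀ n → ℕ.NonZero (x n)) → ℕ → ℚ
θ² x x≢0 k =
  _/_ (+ (x (2 ℕ.+ k) ℕ.* x k)) (x (1 ℕ.+ k) ℕ.* x (1 ℕ.+ k))
      {{m*n≢0 (x (1 ℕ.+ k)) (x (1 ℕ.+ k)) {{x≢0 (1 ℕ.+ k)}} {{x≢0 (1 ℕ.+ k)}}}}

_÷ℕ_ : ℚ → (n : ℕ) → .{{ℕ.NonZero n}} → ℚ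
q ÷ℕ n = q ℚ.* (+ 1 / n)

{-# OPTIONS --safe #-}

-- With r n = x (n + 1) / x n the recurrence reads r (n + 1) = r n · (F n (x n) (x (n + 1)) + 1),
-- so everything is a positive integer, and r grows since F n is positive at positive
-- arguments.  If s k is the k-th partial sum of the series, the convergents are
--   P (2k) = x k · s k,                        Q (2k) = x k,
--   P (2k + 1) = r k · s (k + 1) - h · s k,    Q (2k + 1) = r k - h.
-- Once r k ≥ 2h, each term t k of the series is at most half the preceding one, and the
-- later partial sums as well as P (2k) / Q (2k) and P (2k + 1) / Q (2k + 1) all lie between
-- s k and s k + 2 · t k.
module Submission where

open import Defs
open import Data.Nat.Base as ℕ using (ℕ; zero; suc; NonZero; ⌊_/2⌋)
open import Data.Nat.Coprimality as Coprimality using (1-coprimeTo)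
open import Data.Nat.Divisibility
  using (_∣_; _∣0; ∣m∣n⇒∣m+n; ∣m⇒∣m*n; m∣m*n; ∣-refl; quotient)
import Data.Nat.Properties as ℕ
import Data.Nat.Solver
open import Data.Integer.Base as ℤ using (ℤ; +_; -[1+_])
import Data.Integer.Properties as ℤ
open import Data.List.Base using ([]; _∷_)
open import Data.Product using (Σ-syntax; ∃-syntax; _×_; _,_; proj₁; proj₂)
open import Data.Rational.Base as ℚ
  using (ℚ; mkℚ; 0ℚ; 1ℚ; _/_; _÷_; 1/_; ∣_∣; toℚᵘ; Positive; NonNegative; ↥_; ↧_; ↧ₙ_)
import Data.Rational.Properties as ℚ
import Data.Rational.Solver
open import Data.Rational.Unnormalised.Base as ℚᵘ using (mkℚᵘ; *≡*)
import Data.Rational.Unnormalised.Properties as ℚᵘ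
open import Data.Sum.Base using (_⊎_; inj₁; inj₂)
open import Relation.Binary.PropositionalEquality
  using (_≡_; refl; sym; trans; cong; cong₂; subst; subst₂; module ≡-Reasoning)
open import Algebra.Definitions.RawSemiring ℕ.+-*-rawSemiring using () renaming (_×_ to _·ℕ_)
open import Algebra.Definitions.RawSemiring ℚ.+-*-rawSemiring using () renaming (_×_ to _·ℚ_)

module ℕ-Solver = Data.Nat.Solver.+-*-Solver
module ℚ-Solver = Data.Rational.Solver.+-*-Solver

-- Integers and naturals as rationals

-- `i / 1` normalises through a gcd that is stuck on a variable `i`; once numerator and denominator
-- are exposed, the operations and the order of ℚ compute.
fromℤ≡mkℚ : ∀ i → fromℤ i ≡ mkℚ i 0 (Coprimality.sym (1-coprimeTo ℤ.∣ i ∣))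
fromℤ≡mkℚ (+ n)      = ℚ.normalize-coprime _
fromℤ≡mkℚ (-[1+ n ]) = cong ℚ.-_ (ℚ.normalize-coprime {suc n} _)

fromℤ-homo-+ : ∀ i j → fromℤ (i ℤ.+ j) ≡ fromℤ i ℚ.+ fromℤ j
fromℤ-homo-+ i j = begin
  fromℤ (i ℤ.+ j)                        ≡⟨ cong fromℤ (cong₂ ℤ._+_ (ℤ.*-identityʳ i) (ℤ.*-identityʳ j)) ⟨
  fromℤ (i ℤ.* ℤ.1ℤ ℤ.+ j ℤ.* ℤ.1ℤ)      ≡⟨ cong₂ ℚ._+_ (fromℤ≡mkℚ i) (fromℤ≡mkℚ j) ⟨
  fromℤ i ℚ.+ fromℤ j                    ∎
  where open ≡-Reasoning

fromℤ-homo-* : ∀ i j → fromℤ (i ℤ.* j) ≡ fromℤ i ℚ.* fromℤ j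
fromℤ-homo-* i j = sym (cong₂ ℚ._*_ (fromℤ≡mkℚ i) (fromℤ≡mkℚ j))

fromℤ-homo-neg : ∀ i → fromℤ (ℤ.- i) ≡ ℚ.- fromℤ i
fromℤ-homo-neg (+ zero)   = refl
fromℤ-homo-neg (+ suc n)  = refl
fromℤ-homo-neg (-[1+ n ]) = trans (fromℤ≡mkℚ (+ suc n)) (cong ℚ.-_ (sym (fromℤ≡mkℚ (-[1+ n ]))))

fromℤ-homo-minus : ∀ i j → fromℤ (i ℤ.- j) ≡ fromℤ i ℚ.- fromℤ j
fromℤ-homo-minus i j = trans (fromℤ-homo-+ i (ℤ.- j)) (cong (fromℤ i ℚ.+_) (fromℤ-homo-neg j))

fromℕ-homo-+ : ∀ m n → fromℕ (m ℕ.+ n) ≡ fromℕ m ℚ.+ fromℕ n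
fromℕ-homo-+ m n = fromℤ-homo-+ (+ m) (+ n)

fromℕ-homo-* : ∀ m n → fromℕ (m ℕ.* n) ≡ fromℕ m ℚ.* fromℕ n
fromℕ-homo-* m n = trans (cong fromℤ (ℤ.pos-* m n)) (fromℤ-homo-* (+ m) (+ n))

fromℤ-mono-≤ : ∀ {i j} → i ℤ.≤ j → fromℤ i ℚ.≤ fromℤ j
fromℤ-mono-≤ {i} {j} i≤j = subst₂ ℚ._≤_ (sym (fromℤ≡mkℚ i)) (sym (fromℤ≡mkℚ j))
  (ℚ.*≤* (subst₂ ℤ._≤_ (sym (ℤ.*-identityʳ i)) (sym (ℤ.*-identityʳ j)) i≤j))

fromℕ-mono-≤ : ∀ {m n} → m ℕ.≤ n → fromℕ m ℚ.≤ fromℕ n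
fromℕ-mono-≤ m≤n = fromℤ-mono-≤ (ℤ.+≤+ m≤n)

fromℕ-pos : ∀ n .{{_ : NonZero n}} → Positive (fromℕ n)
fromℕ-pos n@(suc _) = ℚ.normalize-pos n 1

fromℕ-nonNeg : ∀ n → NonNegative (fromℕ n)
fromℕ-nonNeg n = ℚ.normalize-nonNeg n 1

*-cancelʳ-pos : ∀ {p q} r .{{_ : Positive r}} → p ℚ.* r ≡ q ℚ.* r → p ≡ q
*-cancelʳ-pos r eq = ℚ.≤-antisym
  (ℚ.*-cancelʳ-≤-pos r (ℚ.≤-reflexive eq)) (ℚ.*-cancelʳ-≤-pos r (ℚ.≤-reflexive (sym eq)))

-- In the unnormalised rationals `i / n` is the plain fraction, so the equation is a cross
-- multiplication.
/-*-cancel : ∀ i n .{{_ : NonZero n}} → i / n ℚ.* fromℕ n ≡ fromℤ i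
/-*-cancel i n@(suc m) = ℚ.toℚᵘ-injective (begin
  toℚᵘ (i / n ℚ.* fromℕ n)              ≈⟨ ℚ.toℚᵘ-homo-* (i / n) (fromℕ n) ⟩
  toℚᵘ (i / n) ℚᵘ.* toℚᵘ (fromℕ n)      ≈⟨ ℚᵘ.*-cong (ℚ.toℚᵘ-fromℚᵘ (mkℚᵘ i m)) (ℚ.toℚᵘ-fromℚᵘ (mkℚᵘ (+ n) 0)) ⟩
  mkℚᵘ i m ℚᵘ.* mkℚᵘ (+ n) 0            ≈⟨ *≡* (trans (ℤ.*-identityʳ (i ℤ.* + n)) (cong (i ℤ.*_) (cong +_ (sym (ℕ.*-identityʳ n))))) ⟩
  mkℚᵘ i 0                              ≈⟨ ℚ.toℚᵘ-fromℚᵘ (mkℚᵘ i 0) ⟨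
  toℚᵘ (fromℤ i)                        ∎)
  where
  open import Relation.Binary.Reasoning.Setoid ℚᵘ.≃-setoid

-- Evaluates a quotient by verifying one product, without inspecting its normal form.
/-unique : ∀ i n .{{_ : NonZero n}} q → q ℚ.* fromℕ n ≡ fromℤ i → i / n ≡ q
/-unique i n q eq = *-cancelʳ-pos (fromℕ n) {{fromℕ-pos n}} (trans (/-*-cancel i n) (sym eq))

fromℕ-÷ℕ : ∀ m n .{{_ : NonZero n}} → fromℕ m ÷ℕ n ≡ + m / n
fromℕ-÷ℕ m n = sym (/-unique (+ m) n (fromℕ m ÷ℕ n) (trans (ℚ.*-assoc (fromℕ m) (+ 1 / n) (fromℕ n))
  (trans (cong (fromℕ m ℚ.*_) (/-*-cancel (+ 1) n)) (ℚ.*-identityʳ (fromℕ m)))))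

-- Order and absolute value in ℚ

p≤q⇒0≤q-p : ∀ {p q} → p ℚ.≤ q → 0ℚ ℚ.≤ q ℚ.- p
p≤q⇒0≤q-p {p} {q} p≤q = subst (ℚ._≤ q ℚ.- p) (ℚ.+-inverseʳ p) (ℚ.+-monoˡ-≤ (ℚ.- p) p≤q)

0≤q-p⇒p≤q : ∀ {p q} → 0ℚ ℚ.≤ q ℚ.- p → p ℚ.≤ q
0≤q-p⇒p≤q {p} {q} 0≤q-p = subst₂ ℚ._≤_ (ℚ.+-identityˡ p)
  (solve 2 (λ p q → q :- p :+ p := q) refl p q) (ℚ.+-monoˡ-≤ p 0≤q-p)
  where open ℚ-Solver

*-nonNeg : ∀ {p q} → 0ℚ ℚ.≤ p → 0ℚ ℚ.≤ q → 0ℚ ℚ.≤ p ℚ.* q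
*-nonNeg {p} {q} 0≤p 0≤q = ℚ.nonNegative⁻¹ _
  {{ℚ.nonNeg*nonNeg⇒nonNeg p {{ℚ.nonNegative 0≤p}} q {{ℚ.nonNegative 0≤q}}}}

-- The left end and the length are the parameters because the length bounds the distance of any two
-- members.
_∈[_,+_] : ℚ → ℚ → ℚ → Set
q ∈[ l ,+ e ] = l ℚ.≤ q × q ℚ.≤ l ℚ.+ e

-- For either sign, `e` minus the absolute value is a sum of two non-negative gaps to the ends of
-- the interval.
∣p-q∣≤ : ∀ {l e p q} → p ∈[ l ,+ e ] → q ∈[ l ,+ e ] → ∣ p ℚ.- q ∣ ℚ.≤ e
∣p-q∣≤ {l} {e} {p} {q} (l≤p , p≤u) (l≤q , q≤u) with ℚ.∣p∣≡p∨∣p∣≡-p (p ℚ.- q)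
... | inj₁ eq = subst (ℚ._≤ e) (sym eq) (0≤q-p⇒p≤q (subst (0ℚ ℚ.≤_)
  (solve 4 (λ l e p q → (l :+ e :- p) :+ (q :- l) := e :- (p :- q)) refl l e p q)
  (ℚ.+-mono-≤ (p≤q⇒0≤q-p p≤u) (p≤q⇒0≤q-p l≤q))))
  where open ℚ-Solver
... | inj₂ eq = subst (ℚ._≤ e) (sym eq) (0≤q-p⇒p≤q (subst (0ℚ ℚ.≤_)
  (solve 4 (λ l e p q → (l :+ e :- q) :+ (p :- l) := e :- (:- (p :- q))) refl l e p q)
  (ℚ.+-mono-≤ (p≤q⇒0≤q-p q≤u) (p≤q⇒0≤q-p l≤p))))
  where open ℚ-Solver

÷-*-cancel : ∀ p q .{{_ : ℚ.NonZero q}} → p ÷ q ℚ.* q ≡ p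
÷-*-cancel p q = trans (ℚ.*-assoc p (1/ q) q) (trans (cong (p ℚ.*_) (ℚ.*-inverseˡ q)) (ℚ.*-identityʳ p))

archimedean : ∀ D ε → 0ℚ ℚ.< ε → ∃[ N ] D ℚ.< fromℕ N ℚ.* ε
-- The denominator of `ε` times `ε` is its numerator, which is at least 1; and `a`, the absolute
-- numerator of `D`, bounds `D`.
archimedean D ε 0<ε = suc a ℕ.* ↧ₙ ε , (begin-strict
  D                                          ≤⟨ D≤a ⟩
  fromℕ a                                    <⟨ a<1+a ⟩
  fromℕ (suc a)                              ≡⟨ ℚ.*-identityʳ (fromℕ (suc a)) ⟨
  fromℕ (suc a) ℚ.* 1ℚ                       ≤⟨ ℚ.*-monoˡ-≤-nonNeg (fromℕ (suc a)) {{fromℕ-nonNeg (suc a)}} (fromℤ-mono-≤ 1≤↥ε) ⟩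
  fromℕ (suc a) ℚ.* fromℤ (↥ ε)              ≡⟨ cong (fromℕ (suc a) ℚ.*_) ↧ε*ε ⟨
  fromℕ (suc a) ℚ.* (fromℕ (↧ₙ ε) ℚ.* ε)     ≡⟨ ℚ.*-assoc (fromℕ (suc a)) (fromℕ (↧ₙ ε)) ε ⟨
  fromℕ (suc a) ℚ.* fromℕ (↧ₙ ε) ℚ.* ε       ≡⟨ cong (ℚ._* ε) (fromℕ-homo-* (suc a) (↧ₙ ε)) ⟨
  fromℕ (suc a ℕ.* ↧ₙ ε) ℚ.* ε               ∎)
  where
  open ℚ.≤-Reasoning
  a = ℤ.∣ ↥ D ∣
  ↧ε*ε : fromℕ (↧ₙ ε) ℚ.* ε ≡ fromℤ (↥ ε)
  ↧ε*ε = trans (ℚ.*-comm (fromℕ (↧ₙ ε)) ε)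
    (trans (cong (ℚ._* fromℕ (↧ₙ ε)) (sym (ℚ.↥p/↧p≡p ε))) (/-*-cancel (↥ ε) (↧ₙ ε)))
  1≤↥ε : ℤ.1ℤ ℤ.≤ ↥ ε
  1≤↥ε = ℤ.i<j⇒suc[i]≤j (ℤ.positive⁻¹ (↥ ε)
    {{subst ℤ.Positive (ℚ.↥ᵘ-toℚᵘ ε) (ℚ.positive 0<ε)}})
  a<1+a : fromℕ a ℚ.< fromℕ (suc a)
  a<1+a = subst₂ ℚ._<_ (ℚ.+-identityˡ (fromℕ a)) (sym (fromℕ-homo-+ 1 a))
    (ℚ.+-monoˡ-< (fromℕ a) (ℚ.positive⁻¹ 1ℚ))
  D≤a : D ℚ.≤ fromℕ a
  D≤a = subst (D ℚ.≤_) (sym (fromℤ≡mkℚ (+ a))) (ℚ.*≤* (i≤∣i∣*d (↥ D)))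
    where
    i≤∣i∣*d : ∀ i → i ℤ.* ℤ.1ℤ ℤ.≤ + ℤ.∣ i ∣ ℤ.* ↧ D
    i≤∣i∣*d (+ n)      = ℤ.*-monoˡ-≤-nonNeg (+ n) (ℤ.+≤+ (ℕ.s≤s ℕ.z≤n))
    i≤∣i∣*d (-[1+ n ]) = ℤ.-≤+

-- Polynomials over ℕ

open Evaluation ℕ.+-*-rawSemiring using () renaming (eval₁ to eval₁ℕ)
open Evaluation ℚ.+-*-rawSemiring using () renaming (eval₁ to eval₁ℚ)

·ℕ-1 : ∀ c → c ·ℕ 1 ≡ c
·ℕ-1 zero    = refl
·ℕ-1 (suc c) = cong suc (·ℕ-1 c)

·ℚ-1 : ∀ c → c ·ℚ 1ℚ ≡ fromℕ c
·ℚ-1 zero    = refl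
·ℚ-1 (suc c) = trans (cong (1ℚ ℚ.+_) (·ℚ-1 c)) (sym (fromℕ-homo-+ 1 c))

fromℕ-linear : ∀ a x b {a′ b′} → a′ ≡ fromℕ a → b′ ≡ fromℕ b →
               a′ ℚ.+ fromℕ x ℚ.* b′ ≡ fromℕ (a ℕ.+ x ℕ.* b)
fromℕ-linear a x b refl refl =
  sym (trans (fromℕ-homo-+ a (x ℕ.* b)) (cong (fromℕ a ℚ.+_) (fromℕ-homo-* x b)))

eval₁ℚ-fromℕ : ∀ cs y → eval₁ℚ cs (fromℕ y) ≡ fromℕ (eval₁ℕ cs y)
eval₁ℚ-fromℕ []       y = refl
eval₁ℚ-fromℕ (c ∷ cs) y = fromℕ-linear (c ·ℕ 1) y (eval₁ℕ cs y)
  (trans (·ℚ-1 c) (cong fromℕ (sym (·ℕ-1 c)))) (eval₁ℚ-fromℕ cs y)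

evalℚ-fromℕ : ∀ p x y → evalℚ p (fromℕ x) (fromℕ y) ≡ fromℕ (evalℕ p x y)
evalℚ-fromℕ []       x y = refl
evalℚ-fromℕ (p ∷ ps) x y = fromℕ-linear (eval₁ℕ p y) x (evalℕ ps x y)
  (eval₁ℚ-fromℕ p y) (evalℚ-fromℕ ps x y)

-- Only the constant coefficient survives at 0, so it vanishes, and the rest carries a factor `y`.
∣eval₁ : ∀ cs {d y} → d ∣ y → eval₁ℕ cs 0 ≡ 0 → d ∣ eval₁ℕ cs y
∣eval₁ []       {d} d∣y _   = d ∣0
∣eval₁ (c ∷ cs) {d} d∣y c≡0 = ∣m∣n⇒∣m+n
  (subst (d ∣_) (sym (ℕ.m+n≡0⇒m≡0 (c ·ℕ 1) c≡0)) (d ∣0)) (∣m⇒∣m*n _ d∣y)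

∣eval : ∀ p {d x y} → d ∣ x → d ∣ y → evalℕ p 0 0 ≡ 0 → d ∣ evalℕ p x y
∣eval []       {d} d∣x d∣y _   = d ∣0
∣eval (p ∷ ps) {d} d∣x d∣y p≡0 = ∣m∣n⇒∣m+n
  (∣eval₁ p d∣y (ℕ.m+n≡0⇒m≡0 (eval₁ℕ p 0) p≡0)) (∣m⇒∣m*n _ d∣x)

m*n≡0⇒n≡0 : ∀ m .{{_ : NonZero m}} {n} → m ℕ.* n ≡ 0 → n ≡ 0
m*n≡0⇒n≡0 m {n} eq = ℕ.*-cancelˡ-≡ n 0 m (trans eq (sym (ℕ.*-zeroʳ m)))

-- A sum of naturals vanishes only if every summand does; cancelling the positive `y` then exposes
-- the next coefficient.
eval₁≡0⇒nth≡0 : ∀ cs y .{{_ : NonZero y}} → eval₁ℕ cs y ≡ 0 → ∀ j → nth 0 cs j ≡ 0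
eval₁≡0⇒nth≡0 []       y eq j       = refl
eval₁≡0⇒nth≡0 (c ∷ cs) y eq zero    = trans (sym (·ℕ-1 c)) (ℕ.m+n≡0⇒m≡0 (c ·ℕ 1) eq)
eval₁≡0⇒nth≡0 (c ∷ cs) y eq (suc j) =
  eval₁≡0⇒nth≡0 cs y (m*n≡0⇒n≡0 y (ℕ.m+n≡0⇒n≡0 (c ·ℕ 1) eq)) j

eval≡0⇒coeff≡0 : ∀ p x y .{{_ : NonZero x}} .{{_ : NonZero y}} →
                 evalℕ p x y ≡ 0 → ∀ i j → coeff p i j ≡ 0
eval≡0⇒coeff≡0 []       x y eq i       j = refl
eval≡0⇒coeff≡0 (p ∷ ps) x y eq zero    j =
  eval₁≡0⇒nth≡0 p y (ℕ.m+n≡0⇒m≡0 (eval₁ℕ p y) eq) j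
eval≡0⇒coeff≡0 (p ∷ ps) x y eq (suc i) j =
  eval≡0⇒coeff≡0 ps x y (m*n≡0⇒n≡0 x (ℕ.m+n≡0⇒n≡0 (eval₁ℕ p y) eq)) i j

eval≢0 : ∀ p x y .{{_ : NonZero x}} .{{_ : NonZero y}} → NonZeroPoly p → NonZero (evalℕ p x y)
eval≢0 p x y p≢0 = ℕ.≢-nonZero λ eq → p≢0 (eval≡0⇒coeff≡0 p x y eq)

-- The solution of the recurrence in ℕ

module Recurrence (F : ℕ → Poly) (p : ℕ) where

  -- Running the recurrence on the ratio `r` avoids division in ℕ and makes the divisibility of
  -- consecutive terms immediate.
  z r : ℕ → ℕ
  z zero    = 1
  z (suc n) = z n ℕ.* r n
  r zero    = p
  r (suc n) = r n ℕ.* (evalℕ (F n) (z n) (z n ℕ.* r n) ℕ.+ 1)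

  f : ℕ → ℕ
  f n = evalℕ (F n) (z n) (z (suc n))

  z-step : ∀ n → z (2 ℕ.+ n) ℕ.* z n ≡ (z (suc n) ℕ.* z (suc n)) ℕ.* (f n ℕ.+ 1)
  z-step n = solve 3 (λ z r f →
      (z :* r) :* (r :* (f :+ con 1)) :* z := (z :* r) :* (z :* r) :* (f :+ con 1))
    refl (z n) (r n) (f n)
    where open ℕ-Solver

  z∣z : ∀ n → z n ∣ z (suc n)
  z∣z n = m∣m*n (r n)

  module _ .{{p≢0 : NonZero p}} where

    mutual
      z≢0 : ∀ n → NonZero (z n)
      z≢0 zero    = _
      z≢0 (suc n) = ℕ.m*n≢0 (z n) (r n) {{z≢0 n}} {{r≢0 n}}

      r≢0 : ∀ n → NonZero (r n)
      -- The instance for `p` is irrelevant; the detour through `p ≢ 0` yields a relevant one.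
      r≢0 zero    = ℕ.≢-nonZero (ℕ.≢-nonZero⁻¹ p)
      r≢0 (suc n) = ℕ.m*n≢0 (r n) (f n ℕ.+ 1) {{r≢0 n}} {{ℕ.≢-nonZero (ℕ.m+1+n≢0 (f n))}}

    -- The recurrence determines `x (2 + n)` after cancelling `x n`, which is positive by induction.
    -- Two consecutive values are carried along because each step uses both.
    unique : (x : ℕ → ℚ) → x 0 ≡ 1ℚ → x 1 ≡ fromℕ p →
             (∀ n → x (2 ℕ.+ n) ℚ.* x n
                      ≡ (x (suc n) ℚ.* x (suc n)) ℚ.* (evalℚ (F n) (x n) (x (suc n)) ℚ.+ 1ℚ)) →
             ∀ n → x n ≡ fromℕ (z n)
    unique x x₀ x₁ x-step n = proj₁ (pair n)
      where
      pair : ∀ n → x n ≡ fromℕ (z n) × x (suc n) ≡ fromℕ (z (suc n))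
      pair zero    = x₀ , trans x₁ (cong fromℕ (sym (ℕ.*-identityˡ p)))
      pair (suc n) = let xₙ , xₙ₊₁ = pair n in
        xₙ₊₁ , *-cancelʳ-pos (fromℕ (z n)) {{fromℕ-pos (z n) {{z≢0 n}}}} (begin
          x (2 ℕ.+ n) ℚ.* fromℕ (z n)
            ≡⟨ cong (x (2 ℕ.+ n) ℚ.*_) xₙ ⟨
          x (2 ℕ.+ n) ℚ.* x n
            ≡⟨ x-step n ⟩
          (x (suc n) ℚ.* x (suc n)) ℚ.* (evalℚ (F n) (x n) (x (suc n)) ℚ.+ 1ℚ)
            ≡⟨ cong₂ (λ u v → (v ℚ.* v) ℚ.* (evalℚ (F n) u v ℚ.+ 1ℚ)) xₙ xₙ₊₁ ⟩
          (Z₁ ℚ.* Z₁) ℚ.* (evalℚ (F n) (fromℕ (z n)) Z₁ ℚ.+ 1ℚ)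
            ≡⟨ cong₂ ℚ._*_ (sym (fromℕ-homo-* (z (suc n)) (z (suc n))))
                 (trans (cong (ℚ._+ 1ℚ) (evalℚ-fromℕ (F n) (z n) (z (suc n)))) (sym (fromℕ-homo-+ (f n) 1))) ⟩
          fromℕ (z (suc n) ℕ.* z (suc n)) ℚ.* fromℕ (f n ℕ.+ 1)
            ≡⟨ fromℕ-homo-* (z (suc n) ℕ.* z (suc n)) (f n ℕ.+ 1) ⟨
          fromℕ ((z (suc n) ℕ.* z (suc n)) ℕ.* (f n ℕ.+ 1))
            ≡⟨ cong fromℕ (z-step n) ⟨
          fromℕ (z (2 ℕ.+ n) ℕ.* z n)
            ≡⟨ fromℕ-homo-* (z (2 ℕ.+ n)) (z n) ⟩
          fromℕ (z (2 ℕ.+ n)) ℚ.* fromℕ (z n)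
            ∎)
        where
        open ≡-Reasoning
        Z₁ = fromℕ (z (suc n))

    θ²-1≡f : ∀ n → θ² z z≢0 n ℚ.- 1ℚ ≡ fromℕ (f n)
    θ²-1≡f n = begin
      θ² z z≢0 n ℚ.- 1ℚ
        ≡⟨ cong (ℚ._- 1ℚ) (/-unique (+ (z (2 ℕ.+ n) ℕ.* z n)) zz {{zz≢0}} (fromℕ (f n ℕ.+ 1)) (begin
             fromℕ (f n ℕ.+ 1) ℚ.* fromℕ zz  ≡⟨ ℚ.*-comm (fromℕ (f n ℕ.+ 1)) (fromℕ zz) ⟩
             fromℕ zz ℚ.* fromℕ (f n ℕ.+ 1)  ≡⟨ fromℕ-homo-* zz (f n ℕ.+ 1) ⟨
             fromℕ (zz ℕ.* (f n ℕ.+ 1))      ≡⟨ cong fromℕ (z-step n) ⟨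
             fromℕ (z (2 ℕ.+ n) ℕ.* z n)     ∎)) ⟩
      fromℕ (f n ℕ.+ 1) ℚ.- 1ℚ
        ≡⟨ cong (ℚ._- 1ℚ) (fromℕ-homo-+ (f n) 1) ⟩
      fromℕ (f n) ℚ.+ 1ℚ ℚ.- 1ℚ
        ≡⟨ solve 1 (λ f → f :+ con 1ℚ :- con 1ℚ := f) refl (fromℕ (f n)) ⟩
      fromℕ (f n) ∎
      where
      open ≡-Reasoning
      open ℚ-Solver
      zz = z (suc n) ℕ.* z (suc n)
      zz≢0 = ℕ.m*n≢0 (z (suc n)) (z (suc n)) {{z≢0 (suc n)}} {{z≢0 (suc n)}}

-- Limits of bracketed sequences

-- One-sided, since it is meant for lengths of intervals, which are non-negative.
Vanishes : (ℕ → ℚ) → Set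
Vanishes e = ∀ ε → 0ℚ ℚ.< ε → ∃[ N ] ∀ n → N ℕ.≤ n → e n ℚ.< ε

module Bracketing
  (s e : ℕ → ℚ) (K : ℕ) (e→0 : Vanishes e)
  (s∈ : ∀ {k m} → K ℕ.≤ k → k ℕ.≤ m → s m ∈[ s k ,+ e k ])
  where

  -- The sequence `s` represents its own limit: from `K ⊔ N` on, all its terms lie in a single
  -- interval of length below `ε`.
  limit : ℝ
  limit .approx = s
  limit .cauchy ε 0<ε = let N , e<ε = e→0 ε 0<ε in K ℕ.⊔ N , λ m n N≤m N≤n →
    ℚ.≤-<-trans
      (∣p-q∣≤ (s∈ (ℕ.m≤m⊔n K N) N≤m) (s∈ (ℕ.m≤m⊔n K N) N≤n))
      (e<ε (K ℕ.⊔ N) (ℕ.m≤n⊔m K N))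

  -- The margin required by ∣_-_∣<_ is ε - ε/2.
  bracketed→limit : (u : ℕ → ℚ) (κ : ℕ → ℕ) → (∀ N → ∃[ I ] ∀ i → I ℕ.≤ i → N ℕ.≤ κ i) →
                    (∀ i → K ℕ.≤ κ i → u i ∈[ s (κ i) ,+ e (κ i) ]) → u ⟶ limit
  bracketed→limit u κ κ→∞ u∈ ε 0<ε =
    I , λ i I≤i → let K⊔N≤κ = κ≥ i I≤i ; K≤κ = ℕ.≤-trans (ℕ.m≤m⊔n K N) K⊔N≤κ in
      -- The interval of index `κ i` contains `u i` and all later terms of `s`, so `κ i` is the
      -- threshold for `m`.
      η , 0<η , κ i , λ m κ≤m → subst (∣ u i ℚ.- s m ∣ ℚ.+ η ℚ.≤_) η+η≡ε (ℚ.+-monoˡ-≤ η (ℚ.<⇒≤ (ℚ.≤-<-trans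
        (∣p-q∣≤ (u∈ i K≤κ) (s∈ K≤κ κ≤m))
        (e<η (κ i) (ℕ.≤-trans (ℕ.m≤n⊔m K N) K⊔N≤κ)))))
    where
    η = ε ℚ.* ℚ.½
    0<η : 0ℚ ℚ.< η
    0<η = ℚ.positive⁻¹ η {{ℚ.pos*pos⇒pos ε {{ℚ.positive 0<ε}} ℚ.½}}
    η+η≡ε : η ℚ.+ η ≡ ε
    η+η≡ε = solve 1 (λ ε → ε :* con ℚ.½ :+ ε :* con ℚ.½ := ε) refl ε
      where open ℚ-Solver
    N = proj₁ (e→0 η 0<η)
    e<η = proj₂ (e→0 η 0<η)
    I = proj₁ (κ→∞ (K ℕ.⊔ N))
    κ≥ = proj₂ (κ→∞ (K ℕ.⊔ N))

-- Halving indices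

-- Unlike `2 * suc k`, `double (suc k)` reduces to two successors, so `P` and `Q` unfold at it.
double : ℕ → ℕ
double zero    = zero
double (suc n) = suc (suc (double n))

2*≡double : ∀ n → 2 ℕ.* n ≡ double n
2*≡double zero    = refl
2*≡double (suc n) = cong suc (trans (ℕ.+-suc n (n ℕ.+ 0)) (cong suc (2*≡double n)))

2*+1≡1+double : ∀ n → 2 ℕ.* n ℕ.+ 1 ≡ suc (double n)
2*+1≡1+double n = trans (ℕ.+-comm (2 ℕ.* n) 1) (cong suc (2*≡double n))

⌊double/2⌋ : ∀ n → ⌊ double n /2⌋ ≡ n
⌊double/2⌋ zero    = refl
⌊double/2⌋ (suc n) = cong suc (⌊double/2⌋ n)

parity : ∀ n → n ≡ double ⌊ n /2⌋ ⊎ n ≡ suc (double ⌊ n /2⌋)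
parity zero          = inj₁ refl
parity (suc zero)    = inj₂ refl
parity (suc (suc n)) with parity n
... | inj₁ eq = inj₁ (cong (λ k → suc (suc k)) eq)
... | inj₂ eq = inj₂ (cong (λ k → suc (suc k)) eq)

-- The continued fraction

-- The sequences swap roles at each step, which puts `f` at even and `g` at odd positions without a
-- parity test.
interleave : ∀ {A : Set} → (ℕ → A) → (ℕ → A) → ℕ → A
interleave f g zero    = f 0
interleave f g (suc n) = interleave g (λ k → f (suc k)) n

interleave-double : ∀ {A : Set} (f g : ℕ → A) k → interleave f g (double k) ≡ f k
interleave-double f g zero    = refl
interleave-double f g (suc k) = interleave-double (λ k → f (suc k)) (λ k → g (suc k)) k

-- The polynomials enter only through `c n`, which stands for the quotient of the value of `F n` by
-- `z n`; its positivity makes `r` grow.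
module Expansion
  (z r c : ℕ → ℕ) (z≢0 : ∀ n → NonZero (z n)) (r≢0 : ∀ n → NonZero (r n)) (c≢0 : ∀ n → NonZero (c n))
  (z-zero : z 0 ≡ 1) (z-suc : ∀ n → z (suc n) ≡ z n ℕ.* r n)
  (r-suc : ∀ n → r (suc n) ≡ r n ℕ.* (c n ℕ.* z n ℕ.+ 1))
  (h : ℕ) .{{h≢0 : NonZero h}}
  where

  t s : ℕ → ℚ
  t n = _/_ (+ (h ℕ.^ n)) (z (suc n)) {{z≢0 (suc n)}}
  s = partialSum t

  a b : ℕ → ℤ
  a = interleave (λ _ → + h) (λ _ → + 1)
  b zero          = + 0
  b (suc zero)    = + z 1 ℤ.- + h
  -- The shift by two places `z k` at index 2k + 2 and `c k` at index 2k + 3.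
  b (suc (suc n)) = interleave (λ k → + z k) (λ k → + c k) n

  a-even : ∀ k → a (double k) ≡ + h
  a-even = interleave-double _ _

  a-odd : ∀ k → a (suc (double k)) ≡ + 1
  -- One unfolding of `interleave` turns odd positions into even positions of the swapped pair.
  a-odd = interleave-double _ _

  b-even : ∀ k → b (double (suc k)) ≡ + z k
  b-even = interleave-double _ _

  b-odd : ∀ k → b (suc (double (suc k))) ≡ + c k
  b-odd = interleave-double _ _

  a-2* : ∀ k → a (2 ℕ.* k) ≡ + h
  a-2* k = trans (cong a (2*≡double k)) (a-even k)

  a-2*+1 : ∀ k → a (2 ℕ.* k ℕ.+ 1) ≡ + 1
  a-2*+1 k = trans (cong a (2*+1≡1+double k)) (a-odd k)

  b-2* : ∀ k → b (2 ℕ.* suc k) ≡ + z k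
  b-2* k = trans (cong b (2*≡double (suc k))) (b-even k)

  b-2*+1 : ∀ k → b (2 ℕ.* suc k ℕ.+ 1) ≡ + c k
  b-2*+1 k = trans (cong b (2*+1≡1+double (suc k))) (b-odd k)

  H : ℚ
  H = fromℕ h
  Z R C : ℕ → ℚ
  Z n = fromℕ (z n)
  R n = fromℕ (r n)
  C n = fromℕ (c n)

  0<H : 0ℚ ℚ.< H
  0<H = ℚ.positive⁻¹ H {{fromℕ-pos h}}

  Z-pos : ∀ n → Positive (Z n)
  Z-pos n = fromℕ-pos (z n) {{z≢0 n}}

  Z-zero : Z 0 ≡ 1ℚ
  Z-zero = cong fromℕ z-zero

  Z-suc : ∀ n → Z (suc n) ≡ Z n ℚ.* R n
  Z-suc n = trans (cong fromℕ (z-suc n)) (fromℕ-homo-* (z n) (r n))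

  R-suc : ∀ n → R (suc n) ≡ R n ℚ.* (C n ℚ.* Z n ℚ.+ 1ℚ)
  R-suc n = trans (cong fromℕ (r-suc n)) (trans (fromℕ-homo-* (r n) (c n ℕ.* z n ℕ.+ 1))
    (cong (R n ℚ.*_) (trans (fromℕ-homo-+ (c n ℕ.* z n) 1)
      (cong (ℚ._+ 1ℚ) (fromℕ-homo-* (c n) (z n))))))

  t*Z : ∀ n → t n ℚ.* Z (suc n) ≡ fromℕ (h ℕ.^ n)
  t*Z n = /-*-cancel (+ (h ℕ.^ n)) (z (suc n)) {{z≢0 (suc n)}}

  R*t-zero : R 0 ℚ.* t 0 ≡ 1ℚ
  R*t-zero = begin
    R 0 ℚ.* t 0              ≡⟨ solve 2 (λ R t → R :* t := t :* (con 1ℚ :* R)) refl (R 0) (t 0) ⟩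
    t 0 ℚ.* (1ℚ ℚ.* R 0)     ≡⟨ cong (λ w → t 0 ℚ.* (w ℚ.* R 0)) Z-zero ⟨
    t 0 ℚ.* (Z 0 ℚ.* R 0)    ≡⟨ cong (t 0 ℚ.*_) (Z-suc 0) ⟨
    t 0 ℚ.* Z 1              ≡⟨ t*Z 0 ⟩
    1ℚ                       ∎
    where
    open ≡-Reasoning
    open ℚ-Solver

  -- Consecutive terms have ratio h / r (n + 1), because z (n + 2) = z (n + 1) · r (n + 1). This
  -- drives both the numerators of the convergents and the decay of the terms.
  R*t-suc : ∀ n → R (suc n) ℚ.* t (suc n) ≡ H ℚ.* t n
  R*t-suc n = *-cancelʳ-pos (Z (suc n)) {{Z-pos (suc n)}} (begin
    R (suc n) ℚ.* t (suc n) ℚ.* Z (suc n)    ≡⟨ solve 3 (λ R t Z → R :* t :* Z := t :* (Z :* R)) refl (R (suc n)) (t (suc n)) (Z (suc n)) ⟩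
    t (suc n) ℚ.* (Z (suc n) ℚ.* R (suc n))  ≡⟨ cong (t (suc n) ℚ.*_) (Z-suc (suc n)) ⟨
    t (suc n) ℚ.* Z (2 ℕ.+ n)                ≡⟨ t*Z (suc n) ⟩
    fromℕ (h ℕ.* h ℕ.^ n)                    ≡⟨ fromℕ-homo-* h (h ℕ.^ n) ⟩
    H ℚ.* fromℕ (h ℕ.^ n)                    ≡⟨ cong (H ℚ.*_) (t*Z n) ⟨
    H ℚ.* (t n ℚ.* Z (suc n))                ≡⟨ ℚ.*-assoc H (t n) (Z (suc n)) ⟨
    H ℚ.* t n ℚ.* Z (suc n)                  ∎)
    where
    open ≡-Reasoning
    open ℚ-Solver

  -- Closed forms of the convergents

  open Convergents (λ m → fromℤ (a m)) (λ m → fromℤ (b m))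

  -- Both parities go together because the recurrence has three terms. In the even step the summands
  -- ± h · z k cancel; the odd step is `R-suc`.
  Q-pair : ∀ k → Q (double k) ≡ Z k × Q (suc (double k)) ≡ R k ℚ.- H
  Q-pair zero    = sym Z-zero , trans (fromℤ-homo-minus (+ z 1) (+ h))
    (cong (ℚ._- H) (trans (Z-suc 0) (trans (cong (ℚ._* R 0) Z-zero) (ℚ.*-identityˡ (R 0)))))
  Q-pair (suc k) = even , odd
    where
    open ≡-Reasoning
    open ℚ-Solver
    Q₀ = Q (double k)
    Q₁ = Q (suc (double k))
    even : Q (double (suc k)) ≡ Z (suc k)
    even = begin
      fromℤ (b (double (suc k))) ℚ.* Q₁ ℚ.+ fromℤ (a (double (suc k))) ℚ.* Q₀
        ≡⟨ cong₂ (λ β α → fromℤ β ℚ.* Q₁ ℚ.+ fromℤ α ℚ.* Q₀) (b-even k) (a-even (suc k)) ⟩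
      Z k ℚ.* Q₁ ℚ.+ H ℚ.* Q₀
        ≡⟨ cong₂ (λ q₁ q₀ → Z k ℚ.* q₁ ℚ.+ H ℚ.* q₀) (proj₂ (Q-pair k)) (proj₁ (Q-pair k)) ⟩
      Z k ℚ.* (R k ℚ.- H) ℚ.+ H ℚ.* Z k
        ≡⟨ solve 3 (λ Z R H → Z :* (R :- H) :+ H :* Z := Z :* R) refl (Z k) (R k) H ⟩
      Z k ℚ.* R k
        ≡⟨ Z-suc k ⟨
      Z (suc k) ∎
    odd : Q (suc (double (suc k))) ≡ R (suc k) ℚ.- H
    odd = begin
      fromℤ (b (suc (double (suc k)))) ℚ.* Q (double (suc k)) ℚ.+ fromℤ (a (suc (double (suc k)))) ℚ.* Q₁
        ≡⟨ cong₂ (λ β α → fromℤ β ℚ.* Q (double (suc k)) ℚ.+ fromℤ α ℚ.* Q₁) (b-odd k) (a-odd (suc k)) ⟩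
      C k ℚ.* Q (double (suc k)) ℚ.+ 1ℚ ℚ.* Q₁
        ≡⟨ cong₂ (λ q₂ q₁ → C k ℚ.* q₂ ℚ.+ 1ℚ ℚ.* q₁) (trans even (Z-suc k)) (proj₂ (Q-pair k)) ⟩
      C k ℚ.* (Z k ℚ.* R k) ℚ.+ 1ℚ ℚ.* (R k ℚ.- H)
        ≡⟨ solve 4 (λ C Z R H → C :* (Z :* R) :+ con 1ℚ :* (R :- H) := R :* (C :* Z :+ con 1ℚ) :- H) refl (C k) (Z k) (R k) H ⟩
      R k ℚ.* (C k ℚ.* Z k ℚ.+ 1ℚ) ℚ.- H
        ≡⟨ cong (ℚ._- H) (R-suc k) ⟨
      R (suc k) ℚ.- H ∎

  P-pair : ∀ k → P (double k) ≡ Z k ℚ.* s k × P (suc (double k)) ≡ R k ℚ.* s (suc k) ℚ.- H ℚ.* s k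
  P-pair zero    = sym (ℚ.*-zeroʳ (Z 0)) , sym (begin
    R 0 ℚ.* (0ℚ ℚ.+ t 0) ℚ.- H ℚ.* 0ℚ
      ≡⟨ solve 3 (λ R t H → R :* (con 0ℚ :+ t) :- H :* con 0ℚ := R :* t) refl (R 0) (t 0) H ⟩
    R 0 ℚ.* t 0
      ≡⟨ R*t-zero ⟩
    1ℚ ∎)
    where
    open ≡-Reasoning
    open ℚ-Solver
  P-pair (suc k) = even , odd
    where
    open ≡-Reasoning
    open ℚ-Solver
    P₀ = P (double k)
    P₁ = P (suc (double k))
    even : P (double (suc k)) ≡ Z (suc k) ℚ.* s (suc k)
    even = begin
      fromℤ (b (double (suc k))) ℚ.* P₁ ℚ.+ fromℤ (a (double (suc k))) ℚ.* P₀
        ≡⟨ cong₂ (λ β α → fromℤ β ℚ.* P₁ ℚ.+ fromℤ α ℚ.* P₀) (b-even k) (a-even (suc k)) ⟩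
      Z k ℚ.* P₁ ℚ.+ H ℚ.* P₀
        ≡⟨ cong₂ (λ p₁ p₀ → Z k ℚ.* p₁ ℚ.+ H ℚ.* p₀) (proj₂ (P-pair k)) (proj₁ (P-pair k)) ⟩
      Z k ℚ.* (R k ℚ.* s (suc k) ℚ.- H ℚ.* s k) ℚ.+ H ℚ.* (Z k ℚ.* s k)
        ≡⟨ solve 5 (λ Z R H s s′ → Z :* (R :* s′ :- H :* s) :+ H :* (Z :* s) := Z :* R :* s′)
             refl (Z k) (R k) H (s k) (s (suc k)) ⟩
      Z k ℚ.* R k ℚ.* s (suc k)
        ≡⟨ cong (ℚ._* s (suc k)) (Z-suc k) ⟨
      Z (suc k) ℚ.* s (suc k) ∎
    odd : P (suc (double (suc k))) ≡ R (suc k) ℚ.* s (2 ℕ.+ k) ℚ.- H ℚ.* s (suc k)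
    odd = begin
      fromℤ (b (suc (double (suc k)))) ℚ.* P (double (suc k)) ℚ.+ fromℤ (a (suc (double (suc k)))) ℚ.* P₁
        ≡⟨ cong₂ (λ β α → fromℤ β ℚ.* P (double (suc k)) ℚ.+ fromℤ α ℚ.* P₁) (b-odd k) (a-odd (suc k)) ⟩
      C k ℚ.* P (double (suc k)) ℚ.+ 1ℚ ℚ.* P₁
        ≡⟨ cong₂ (λ p₂ p₁ → C k ℚ.* p₂ ℚ.+ 1ℚ ℚ.* p₁)
             (trans even (cong (ℚ._* s (suc k)) (Z-suc k))) (proj₂ (P-pair k)) ⟩
      C k ℚ.* (Z k ℚ.* R k ℚ.* s (suc k)) ℚ.+ 1ℚ ℚ.* (R k ℚ.* s (suc k) ℚ.- H ℚ.* s k)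
        -- With `s (suc k)` unfolded, - h · s k becomes h · t k - h · s (k + 1); by `R*t-suc`, h · t
        -- k is the contribution of the new term `t (suc k)`.
        ≡⟨ solve 7 (λ C Z R H s t t′ →
               C :* (Z :* R :* (s :+ t)) :+ con 1ℚ :* (R :* (s :+ t) :- H :* s)
                 := R :* (C :* Z :+ con 1ℚ) :* (s :+ t) :+ H :* t :- H :* (s :+ t))
             refl (C k) (Z k) (R k) H (s k) (t k) (t (suc k)) ⟩
      R k ℚ.* (C k ℚ.* Z k ℚ.+ 1ℚ) ℚ.* s (suc k) ℚ.+ H ℚ.* t k ℚ.- H ℚ.* s (suc k)
        ≡⟨ cong₂ (λ R′ ht → R′ ℚ.* s (suc k) ℚ.+ ht ℚ.- H ℚ.* s (suc k)) (R-suc k) (R*t-suc k) ⟨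
      R (suc k) ℚ.* s (suc k) ℚ.+ R (suc k) ℚ.* t (suc k) ℚ.- H ℚ.* s (suc k)
        ≡⟨ cong (ℚ._- H ℚ.* s (suc k)) (ℚ.*-distribˡ-+ (R (suc k)) (s (suc k)) (t (suc k))) ⟨
      R (suc k) ℚ.* s (2 ℕ.+ k) ℚ.- H ℚ.* s (suc k) ∎

  -- Growth of the ratio and decay of the terms

  n<r : ∀ n → n ℕ.< r n
  n<r zero    = ℕ.>-nonZero⁻¹ (r 0) {{r≢0 0}}
  n<r (suc n) = begin-strict
    suc n                          ≤⟨ n<r n ⟩
    -- The factor is at least 2, so `r` gains at least 1 per step; this crude bound suffices to pass
    -- 2h.
    r n                            <⟨ ℕ.m<m*n (r n) (c n ℕ.* z n ℕ.+ 1) {{r≢0 n}} 1<cz+1 ⟩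
    r n ℕ.* (c n ℕ.* z n ℕ.+ 1)    ≡⟨ r-suc n ⟨
    r (suc n)                      ∎
    where
    open ℕ.≤-Reasoning
    1<cz+1 : 1 ℕ.< c n ℕ.* z n ℕ.+ 1
    1<cz+1 = ℕ.m<n+m 1 (ℕ.>-nonZero⁻¹ _ {{ℕ.m*n≢0 (c n) (z n) {{c≢0 n}} {{z≢0 n}}}})

  0≤t : ∀ n → 0ℚ ℚ.≤ t n
  0≤t n = ℚ.nonNegative⁻¹ (t n) {{ℚ.normalize-nonNeg (h ℕ.^ n) (z (suc n)) {{z≢0 (suc n)}}}}

  -- From this index on, `n<r` gives r k > 2h, so that each further term is at most half its
  -- predecessor.
  K : ℕ
  K = 2 ℕ.* h

  2H≤R : ∀ {k} → K ℕ.≤ k → H ℚ.+ H ℚ.≤ R k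
  2H≤R {k} K≤k = subst (ℚ._≤ R k) (trans (fromℕ-homo-+ h (h ℕ.+ 0)) (cong (λ m → H ℚ.+ fromℕ m) (ℕ.+-identityʳ h)))
    (fromℕ-mono-≤ (ℕ.<⇒≤ (ℕ.≤-<-trans K≤k (n<r k))))

  -- When terms at least halve, 2 · t n bounds the tail t n + t (n + 1) + ⋯ by comparison with a
  -- geometric series.
  e : ℕ → ℚ
  e n = t n ℚ.+ t n

  0≤e : ∀ n → 0ℚ ℚ.≤ e n
  0≤e n = ℚ.+-mono-≤ (0≤t n) (0≤t n)

  e-suc≤t : ∀ {k} → K ℕ.≤ k → e (suc k) ℚ.≤ t k
  e-suc≤t {k} K≤k = ℚ.*-cancelˡ-≤-pos H {{fromℕ-pos h}} (begin
    H ℚ.* e (suc k)                ≡⟨ solve 2 (λ H t → H :* (t :+ t) := (H :+ H) :* t) refl H (t (suc k)) ⟩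
    (H ℚ.+ H) ℚ.* t (suc k)        ≤⟨ ℚ.*-monoʳ-≤-nonNeg (t (suc k)) {{ℚ.nonNegative (0≤t (suc k))}} (2H≤R (ℕ.m≤n⇒m≤1+n K≤k)) ⟩
    R (suc k) ℚ.* t (suc k)        ≡⟨ R*t-suc k ⟩
    H ℚ.* t k                      ∎)
    where
    open ℚ.≤-Reasoning
    open ℚ-Solver

  -- The intervals are nested: the left ends increase, and s (k + 1) + e (k + 1) ≤ s (k + 1) + t k =
  -- s k + e k.
  s∈ : ∀ {k m} → K ℕ.≤ k → k ℕ.≤ m → s m ∈[ s k ,+ e k ]
  s∈ {k} {m} K≤k k≤m = s-mono , ℚ.≤-trans s≤s+e s+e-anti
    where
    s-step : ∀ n → s n ℚ.≤ s (suc n)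
    s-step n = subst (ℚ._≤ s (suc n)) (ℚ.+-identityʳ (s n)) (ℚ.+-monoʳ-≤ (s n) (0≤t n))
    step : ∀ n → K ℕ.≤ n → s (suc n) ℚ.+ e (suc n) ℚ.≤ s n ℚ.+ e n
    step n K≤n = subst (s (suc n) ℚ.+ e (suc n) ℚ.≤_) (ℚ.+-assoc (s n) (t n) (t n))
      (ℚ.+-monoʳ-≤ (s (suc n)) (e-suc≤t K≤n))
    mono : ∀ {m} → k ℕ.≤′ m → s k ℚ.≤ s m
    mono ℕ.≤′-refl           = ℚ.≤-refl
    mono (ℕ.≤′-step {n} k≤n) = ℚ.≤-trans (mono k≤n) (s-step n)
    anti : ∀ {m} → k ℕ.≤′ m → s m ℚ.+ e m ℚ.≤ s k ℚ.+ e k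
    anti ℕ.≤′-refl           = ℚ.≤-refl
    anti (ℕ.≤′-step {n} k≤n) = ℚ.≤-trans (step n (ℕ.≤-trans K≤k (ℕ.≤′⇒≤ k≤n))) (anti k≤n)
    s-mono = mono (ℕ.≤⇒≤′ k≤m)
    s+e-anti = anti (ℕ.≤⇒≤′ k≤m)
    s≤s+e : s m ℚ.≤ s m ℚ.+ e m
    s≤s+e = subst (ℚ._≤ s m ℚ.+ e m) (ℚ.+-identityʳ (s m)) (ℚ.+-monoʳ-≤ (s m) (0≤e m))

  -- The sequence n · e n decreases from K on, since e halves at each step.
  n*e-bounded : ∀ {m} → K ℕ.≤′ m → fromℕ m ℚ.* e m ℚ.≤ fromℕ K ℚ.* e K
  n*e-bounded ℕ.≤′-refl               = ℚ.≤-refl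
  n*e-bounded (ℕ.≤′-step {n = m} K≤m) = ℚ.≤-trans (begin
    fromℕ (suc m) ℚ.* e (suc m)        ≤⟨ ℚ.*-monoʳ-≤-nonNeg (e (suc m)) {{ℚ.nonNegative (0≤e (suc m))}} (fromℕ-mono-≤ (ℕ.+-monoˡ-≤ m 1≤m)) ⟩
    fromℕ (m ℕ.+ m) ℚ.* e (suc m)      ≡⟨ cong (ℚ._* e (suc m)) (fromℕ-homo-+ m m) ⟩
    (fromℕ m ℚ.+ fromℕ m) ℚ.* e (suc m) ≡⟨ solve 2 (λ m e → (m :+ m) :* e := m :* (e :+ e)) refl (fromℕ m) (e (suc m)) ⟩
    fromℕ m ℚ.* (e (suc m) ℚ.+ e (suc m)) ≤⟨ ℚ.*-monoˡ-≤-nonNeg (fromℕ m) {{fromℕ-nonNeg m}} (ℚ.+-mono-≤ e≤t e≤t) ⟩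
    fromℕ m ℚ.* e m                    ∎) (n*e-bounded K≤m)
    where
    open ℚ.≤-Reasoning
    open ℚ-Solver
    e≤t = e-suc≤t (ℕ.≤′⇒≤ K≤m)
    1≤m : 1 ℕ.≤ m
    1≤m = ℕ.≤-trans (ℕ.>-nonZero⁻¹ K {{ℕ.m*n≢0 2 h}}) (ℕ.≤′⇒≤ K≤m)

  -- For n ≥ N one has n · e n ≤ K · e K < N · ε ≤ n · ε, and the factor n cancels.
  e→0 : Vanishes e
  e→0 ε 0<ε = let N , D<Nε = archimedean (fromℕ K ℚ.* e K) ε 0<ε in K ℕ.⊔ N , λ n K⊔N≤n →
    ℚ.*-cancelˡ-<-nonNeg (fromℕ n) {{fromℕ-nonNeg n}} (ℚ.≤-<-trans
      (n*e-bounded (ℕ.≤⇒≤′ (ℕ.≤-trans (ℕ.m≤m⊔n K N) K⊔N≤n)))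
      (ℚ.<-≤-trans D<Nε (ℚ.*-monoʳ-≤-nonNeg ε {{ℚ.nonNegative (ℚ.<⇒≤ 0<ε)}}
        (fromℕ-mono-≤ (ℕ.≤-trans (ℕ.m≤n⊔m K N) K⊔N≤n)))))

  open Bracketing s e K e→0 s∈ public

  hasSum : HasSum t limit
  hasSum = bracketed→limit s (λ n → n) (λ N → N , λ i N≤i → N≤i) (λ i K≤i → s∈ K≤i ℕ.≤-refl)

  -- Membership of P i / Q i in the k-th interval, multiplied out by the positive `Q i` to keep
  -- division out of the estimates.
  Bracketed : ℕ → ℕ → Set
  Bracketed k i = 0ℚ ℚ.< Q i × s k ℚ.* Q i ℚ.≤ P i × P i ℚ.≤ (s k ℚ.+ e k) ℚ.* Q i

  -- The convergent is exactly `s k`, the left end of the interval.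
  bracketed-even : ∀ k → Bracketed k (double k)
  bracketed-even k = subst (0ℚ ℚ.<_) (sym Q≡) 0<Z ,
    subst₂ (λ q p → s k ℚ.* q ℚ.≤ p) (sym Q≡) (sym P≡) (ℚ.≤-reflexive (ℚ.*-comm (s k) (Z k))) ,
    subst₂ (λ q p → p ℚ.≤ (s k ℚ.+ e k) ℚ.* q) (sym Q≡) (sym P≡)
      (0≤q-p⇒p≤q (subst (0ℚ ℚ.≤_)
        (solve 3 (λ Z s e → e :* Z := (s :+ e) :* Z :- Z :* s) refl (Z k) (s k) (e k))
        (*-nonNeg (0≤e k) (ℚ.<⇒≤ 0<Z))))
    where
    open ℚ-Solver
    Q≡ = proj₁ (Q-pair k)
    P≡ = proj₁ (P-pair k)
    0<Z : 0ℚ ℚ.< Z k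
    0<Z = ℚ.positive⁻¹ (Z k) {{Z-pos k}}

  -- The gaps to the two ends, multiplied by `Q`, are r k · t k and t k · (r k - 2h); the second is
  -- where r k ≥ 2h enters.
  bracketed-odd : ∀ k → K ℕ.≤ k → Bracketed k (suc (double k))
  bracketed-odd k K≤k = subst (0ℚ ℚ.<_) (sym Q≡) 0<R-H ,
    subst₂ (λ q p → s k ℚ.* q ℚ.≤ p) (sym Q≡) (sym P≡)
      (0≤q-p⇒p≤q (subst (0ℚ ℚ.≤_)
        (solve 4 (λ R H s t → R :* t := R :* (s :+ t) :- H :* s :- s :* (R :- H)) refl (R k) H (s k) (t k))
        (*-nonNeg (ℚ.nonNegative⁻¹ (R k) {{fromℕ-nonNeg (r k)}}) (0≤t k)))) ,
    subst₂ (λ q p → p ℚ.≤ (s k ℚ.+ e k) ℚ.* q) (sym Q≡) (sym P≡)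
      (0≤q-p⇒p≤q (subst (0ℚ ℚ.≤_)
        (solve 4 (λ R H s t → t :* (R :- (H :+ H))
            := (s :+ (t :+ t)) :* (R :- H) :- (R :* (s :+ t) :- H :* s)) refl (R k) H (s k) (t k))
        (*-nonNeg (0≤t k) (p≤q⇒0≤q-p (2H≤R K≤k)))))
    where
    open ℚ-Solver
    Q≡ = proj₂ (Q-pair k)
    P≡ = proj₂ (P-pair k)
    0<R-H : 0ℚ ℚ.< R k ℚ.- H
    0<R-H = ℚ.<-≤-trans 0<H (subst (ℚ._≤ R k ℚ.- H)
      (solve 1 (λ H → H :+ H :- H := H) refl H) (ℚ.+-monoˡ-≤ (ℚ.- H) (2H≤R K≤k)))

  bracketed : ∀ i → K ℕ.≤ ⌊ i /2⌋ → Bracketed ⌊ i /2⌋ i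
  bracketed i K≤ with parity i
  ... | inj₁ eq = subst (Bracketed ⌊ i /2⌋) (sym eq) (bracketed-even ⌊ i /2⌋)
  ... | inj₂ eq = subst (Bracketed ⌊ i /2⌋) (sym eq) (bracketed-odd ⌊ i /2⌋ K≤)

  hasContinuedFraction : HasContinuedFraction limit (λ m → fromℤ (a m)) (λ m → fromℤ (b m))
  hasContinuedFraction = M , Q≢0 , bracketed→limit quotients κ
    (λ N → double N , λ i 2N≤i → subst (ℕ._≤ κ i) (⌊double/2⌋ N)
      (ℕ.⌊n/2⌋-mono (ℕ.≤-trans 2N≤i (ℕ.m≤n+m i M))))
    (λ i _ → let _ , lower , upper = bracketed (M ℕ.+ i) (K≤κ i) ; instance Q-posᵢ = Q-pos i in
      ℚ.*-cancelʳ-≤-pos (Q (M ℕ.+ i)) (subst (s (κ i) ℚ.* Q (M ℕ.+ i) ℚ.≤_) (sym (quotients*Q i)) lower) ,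
      ℚ.*-cancelʳ-≤-pos (Q (M ℕ.+ i))
        (subst (ℚ._≤ (s (κ i) ℚ.+ e (κ i)) ℚ.* Q (M ℕ.+ i)) (sym (quotients*Q i)) upper))
    where
    -- Halving an index gives at least `K` precisely from 2K on; there every `Q` is positive.
    M = double K
    κ : ℕ → ℕ
    κ i = ⌊ M ℕ.+ i /2⌋
    K≤κ : ∀ i → K ℕ.≤ κ i
    K≤κ i = subst (ℕ._≤ κ i) (⌊double/2⌋ K) (ℕ.⌊n/2⌋-mono (ℕ.m≤m+n M i))
    Q-pos : ∀ i → Positive (Q (M ℕ.+ i))
    Q-pos i = ℚ.positive (proj₁ (bracketed (M ℕ.+ i) (K≤κ i)))
    Q≢0 : ∀ i → ℚ.NonZero (Q (M ℕ.+ i))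
    Q≢0 i = ℚ.pos⇒nonZero (Q (M ℕ.+ i)) {{Q-pos i}}
    quotients : ℕ → ℚ
    quotients i = (P (M ℕ.+ i) ÷ Q (M ℕ.+ i)) {{Q≢0 i}}
    quotients*Q : ∀ i → quotients i ℚ.* Q (M ℕ.+ i) ≡ P (M ℕ.+ i)
    quotients*Q i = ÷-*-cancel (P (M ℕ.+ i)) (Q (M ℕ.+ i)) {{Q≢0 i}}

-- Integrality of the partial denominators of odd index

module Coefficients
  (F : ℕ → Poly) (F≢0 : ∀ n → NonZeroPoly (F n)) (F₀ : ∀ n → evalℕ (F n) 0 0 ≡ 0)
  (p : ℕ) .{{p≢0 : NonZero p}}
  where

  open Recurrence F p

  -- `z n` divides both arguments of `F n`, which has no constant term.
  z∣f : ∀ n → z n ∣ f n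
  z∣f n = ∣eval (F n) ∣-refl (z∣z n) (F₀ n)

  c : ℕ → ℕ
  c n = quotient (z∣f n)

  f≡c*z : ∀ n → f n ≡ c n ℕ.* z n
  f≡c*z n = _∣_.equality (z∣f n)

  -- A factor of `f n`, which is positive since `F n` is a nonzero polynomial evaluated at positive
  -- arguments.
  c≢0 : ∀ n → NonZero (c n)
  c≢0 n = ℕ.m*n≢0⇒m≢0 (c n) {{subst NonZero (f≡c*z n)
    (eval≢0 (F n) (z n) (z (suc n)) {{z≢0 n}} {{z≢0 (suc n)}} (F≢0 n))}}

  r-suc : ∀ n → r (suc n) ≡ r n ℕ.* (c n ℕ.* z n ℕ.+ 1)
  r-suc n = cong (λ y → r n ℕ.* (y ℕ.+ 1)) (f≡c*z n)

  θ²-quotient : ∀ k → _÷ℕ_ (θ² z z≢0 k ℚ.- 1ℚ) (z k) {{z≢0 k}} ≡ _/_ (+ f k) (z k) {{z≢0 k}}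
  θ²-quotient k = trans (cong (λ q → _÷ℕ_ q (z k) {{z≢0 k}}) (θ²-1≡f k))
    (fromℕ-÷ℕ (f k) (z k) {{z≢0 k}})

  c≡θ²-quotient : ∀ k → fromℕ (c k) ≡ _÷ℕ_ (θ² z z≢0 k ℚ.- 1ℚ) (z k) {{z≢0 k}}
  c≡θ²-quotient k = trans
    (sym (/-unique (+ f k) (z k) {{z≢0 k}} (fromℕ (c k))
      (trans (sym (fromℕ-homo-* (c k) (z k))) (cong fromℕ (sym (f≡c*z k))))))
    (sym (θ²-quotient k))

mainTheorem4 : (F : ℕ → Poly) →
    (∀ n → NonZeroPoly (F n)) →
    (∀ n → evalℕ (F n) 0 0 ≡ 0) →
    (x : ℕ → ℚ) →
    x 0 ≡ 1ℚ →
    (∃[ p ] NonZero p × x 1 ≡ fromℕ p) →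
    (∀ n → x (2 ℕ.+ n) ℚ.* x n
    ≡ (x (1 ℕ.+ n) ℚ.* x (1 ℕ.+ n)) ℚ.* (evalℚ (F n) (x n) (x (1 ℕ.+ n)) ℚ.+ 1ℚ)) →
    Σ[ z ∈ (ℕ → ℕ) ] Σ[ z≢0 ∈ (∀ n → NonZero (z n)) ]
    (∀ n → x n ≡ fromℕ (z n)) ×
    (∀ n → z n ∣ z (1 ℕ.+ n)) ×
    (∀ n → z n ∣ evalℕ (F n) (z n) (z (1 ℕ.+ n))) ×
    ((h : ℕ) → NonZero h →
    Σ[ a ∈ (ℕ → ℤ) ] Σ[ b ∈ (ℕ → ℤ) ]
    a 1 ≡ + 1 ×
    b 1 ≡ + z 1 ℤ.- + h ×
    (∀ j → let k = suc j in
    a (2 ℕ.* k) ≡ + h ×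
    a (2 ℕ.* k ℕ.+ 1) ≡ + 1 ×
    b (2 ℕ.* k) ≡ + z (k ℕ.∸ 1) ×
    fromℤ (b (2 ℕ.* k ℕ.+ 1))
    ≡ _÷ℕ_ (θ² z z≢0 (k ℕ.∸ 1) ℚ.- 1ℚ) (z (k ℕ.∸ 1)) {{z≢0 (k ℕ.∸ 1)}} ×
    _÷ℕ_ (θ² z z≢0 (k ℕ.∸ 1) ℚ.- 1ℚ) (z (k ℕ.∸ 1)) {{z≢0 (k ℕ.∸ 1)}}
    ≡ _/_ (+ evalℕ (F (k ℕ.∸ 1)) (z (k ℕ.∸ 1)) (z k)) (z (k ℕ.∸ 1)) {{z≢0 (k ℕ.∸ 1)}}) ×
    (Σ[ S ∈ ℝ ]
    HasSum (λ n → _/_ (+ (h ℕ.^ n)) (z (1 ℕ.+ n)) {{z≢0 (1 ℕ.+ n)}}) S ×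
    HasContinuedFraction S (λ m → fromℤ (a m)) (λ m → fromℤ (b m))))
mainTheorem4 F F≢0 F₀ x x₀ (p , p≢0 , x₁) x-step =
  z , z≢0 , unique x x₀ x₁ x-step , z∣z , z∣f , λ h h≢0 →
  -- The relations between `z` and `r` hold by definition; only `r-suc` rests on the divisibility of
  -- `f n` by `z n`.
  let open Expansion z r c z≢0 r≢0 c≢0 refl (λ _ → refl) r-suc h {{h≢0}} in
  a , b , refl , refl ,
  (λ k → a-2* (suc k) , a-2*+1 (suc k) , b-2* k ,
    trans (cong fromℤ (b-2*+1 k)) (c≡θ²-quotient k) , θ²-quotient k) ,
  limit , hasSum , hasContinuedFraction
  where
  instance
    p-nonZero = p≢0
  open Recurrence F p
  open Coefficients F F≢0 F₀ p
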